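{- A matrix weighted tree is completely determined by its resistance matrix. That is, if $G$ and $G'$ are matrix weighted trees on the same vertex set $\{1,\dots,n\}$, with all edge weights positive definite matrices of order $k$, and $R(G)=R(G')$, then $G$ and $G'$ have the same edges and the same weight on each edge.
   Context: A matrix weighted graph is a finite, simple, undirected, connected graph in which each edge $ij$ is assigned a weight $W_{ij}=W_{ji}$ that is a (real symmetric) positive definite matrix of a given order $k$. A matrix weighted tree is a matrix weighted graph whose underlying graph is a tree. For a matrix weighted graph $G$ with vertices $1,\dots,n$, the Laplacian $L=L(G)$ is the $nk\times nk$ block matrix with $k\times k$ blocks $L_{ii}=\sum_{j\sim i}W_{ij}^{ -1}$, $L_{ij}=-W_{ij}^{ -1}$ if $i\neq j$ and $i\sim j$, and $L_{ij}=0$ if $i\ne j$ and $i\nsim j$. A $(1)$-inverse of a matrix $M$ is a matrix $C$ with $MCM=M$. The resistance matrix $R=R(G)$ is the $nk\times nk$ block matrix with blocks $R_{ij}=L^{(1)}_{ii}+L^{(1)}_{jj}-L^{(1)}_{ij}-L^{(1)}_{ji}$, where $L^{(1)}$ is any $(1)$-inverse of $L$ (the result does not depend on the choice). -}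

module Defs where

open import Level using (Level; _⊔_; 0ℓ) renaming (suc to lsuc)
open import Data.Bool.Base using (Bool; T)
open import Data.Bool.Properties using (T?)
open import Data.Fin.Base using (Fin; zero; suc; combine; remQuot)
open import Data.Fin.Properties using (_≟_)
open import Data.List.Base using (_∷_; _∷ʳ_)
open import Data.List.Relation.Unary.Linked using (Linked)
open import Data.List.Relation.Unary.Unique.Propositional using (Unique)
open import Data.Nat.Base as ℕ using (ℕ; zero; suc)
open import Data.Product.Base using (∃-syntax; _×_; _,_; proj₁; proj₂)
open import Data.Sum.Base using (_⊎_; inj₂)
open import Data.Vec.Functional using (Vector)
open import Function.Bundles using (_⇔_; Equivalence)
open import Relation.Binary.Construct.Closure.ReflexiveTransitive using (Star)
open import Relation.Binary.Core using (Rel)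
open import Relation.Binary.Definitions using (Symmetric; Irreflexive)
open import Relation.Binary.PropositionalEquality.Core using (_≡_)
open import Relation.Binary.Structures using (IsStrictPartialOrder)
open import Relation.Nullary using (¬_; yes; no)
open import Algebra.Apartness.Bundles using (HeytingField)
open import Algebra.Bundles using (CommutativeRing)
import Algebra.Definitions.RawMonoid as RawMonoidDefinitions
import Algebra.Properties.Ring as RingProperties
import Algebra.Properties.Semiring.Sum as SemiringSum
import Relation.Binary.Reasoning.Setoid as SetoidReasoning

-- The library has no real numbers.  They are axiomatised as an Archimedean,
-- Cauchy complete ordered field.  Classically this determines ℝ up to
-- isomorphism.  Trichotomy is deliberately absent: the apartness relation of
-- the Heyting field takes its place, so Bishop's reals are a model too.

record RealNumbers (c ℓ₁ ℓ₂ : Level) : Set (lsuc (c ⊔ ℓ₁ ⊔ ℓ₂)) where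
  infix 4 _<_
  field
    heytingField : HeytingField c ℓ₁ ℓ₂

  open HeytingField heytingField public
    using (Carrier; _≈_; _#_; _+_; _*_; -_; 0#; 1#; heytingCommutativeRing;
           #-irrefl; #-sym; #-cotrans; #⇒invertible; invertible⇒#; tight)

  commutativeRing : CommutativeRing c ℓ₁
  commutativeRing = record
    { isCommutativeRing = HeytingField.isCommutativeRing heytingField }

  open CommutativeRing commutativeRing public
    hiding (Carrier; _≈_; _+_; _*_; -_; 0#; 1#; zero)
  open RawMonoidDefinitions +-rawMonoid public
    using () renaming (_×_ to _·_)

  field
    _<_                    : Rel Carrier ℓ₂
    <-isStrictPartialOrder : IsStrictPartialOrder _≈_ _<_
    #⇔<⊎>                  : ∀ {x y} → (x # y) ⇔ (x < y ⊎ y < x)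
    +-monoˡ-<              : ∀ z {x y} → x < y → (x + z) < (y + z)
    *-pos                  : ∀ {x y} → 0# < x → 0# < y → 0# < (x * y)
    archimedean            : ∀ x → ∃[ n ] x < (n · 1#)

  Cauchy : (ℕ → Carrier) → Set (c ⊔ ℓ₂)
  Cauchy s = ∀ ε → 0# < ε → ∃[ N ] (∀ m n → N ℕ.≤ m → N ℕ.≤ n →
               (s m - s n) < ε)

  _ConvergesTo_ : (ℕ → Carrier) → Carrier → Set (c ⊔ ℓ₂)
  s ConvergesTo l = ∀ ε → 0# < ε → ∃[ N ] (∀ n → N ℕ.≤ n →
                      (s n - l) < ε × (l - s n) < ε)

  field
    complete : ∀ s → Cauchy s → ∃[ l ] s ConvergesTo l


record SimpleGraph (n : ℕ) : Set where
  infix 4 _~_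
  field
    adjacent : Fin n → Fin n → Bool

  _~_ : Rel (Fin n) 0ℓ
  i ~ j = T (adjacent i j)

  field
    ~-sym    : Symmetric _~_
    ~-irrefl : Irreflexive _≡_ _~_

  Connected : Set
  Connected = ∀ i j → Star _~_ i j

  -- A cycle is a list x, y, z, … of at least three distinct vertices, each
  -- adjacent to the next one and the last one adjacent to x.
  Acyclic : Set
  Acyclic = ∀ x y z vs → Unique (x ∷ y ∷ z ∷ vs) →
            ¬ Linked _~_ ((x ∷ y ∷ z ∷ vs) ∷ʳ x)

  IsTree : Set
  IsTree = Connected × Acyclic


module Matrices {c ℓ₁ ℓ₂ : Level} (ℝ : RealNumbers c ℓ₁ ℓ₂) where

  open RealNumbers ℝ
  open SemiringSum semiring
  open RingProperties ring using (-‿distribʳ-*; -‿distribˡ-*; -‿+-comm; -0#≈0#)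

  infix  4 _≋_
  infixl 6 _+ᴹ_ _-ᴹ_
  infixl 7 _*ᴹ_ _*ᵛ_ _∙_

  Matrix : ℕ → ℕ → Set c
  Matrix m n = Fin m → Fin n → Carrier

  _≋_ : ∀ {m n} → Rel (Matrix m n) ℓ₁
  A ≋ B = ∀ i j → A i j ≈ B i j

  0ᴹ : ∀ {m n} → Matrix m n
  0ᴹ i j = 0#

  1ᴹ : ∀ {n} → Matrix n n
  1ᴹ zero    zero    = 1#
  1ᴹ zero    (suc j) = 0#
  1ᴹ (suc i) zero    = 0#
  1ᴹ (suc i) (suc j) = 1ᴹ i j

  _+ᴹ_ _-ᴹ_ : ∀ {m n} → Matrix m n → Matrix m n → Matrix m n
  (A +ᴹ B) i j = A i j + B i j
  (A -ᴹ B) i j = A i j - B i j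

  -ᴹ_ : ∀ {m n} → Matrix m n → Matrix m n
  (-ᴹ A) i j = - A i j

  _*ᴹ_ : ∀ {l m n} → Matrix l m → Matrix m n → Matrix l n
  _*ᴹ_ {m = m} A B i j = ∑[ p < m ] (A i p * B p j)

  sumᴹ : ∀ {l m n} → (Fin l → Matrix m n) → Matrix m n
  sumᴹ {l} A i j = ∑[ p < l ] A p i j

  _∙_ : ∀ {n} → Vector Carrier n → Vector Carrier n → Carrier
  _∙_ {n} x y = ∑[ i < n ] (x i * y i)

  _*ᵛ_ : ∀ {m n} → Matrix m n → Vector Carrier n → Vector Carrier m
  (A *ᵛ x) i = A i ∙ x

  -- Constructively a vector is nonzero when some entry is apart from 0.
  Nonzero : ∀ {n} → Vector Carrier n → Set ℓ₂
  Nonzero x = ∃[ i ] x i # 0#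

  record PositiveDefinite {n} (A : Matrix n n) : Set (c ⊔ ℓ₁ ⊔ ℓ₂) where
    field
      symmetric : ∀ i j → A i j ≈ A j i
      positive  : ∀ x → Nonzero x → 0# < x ∙ (A *ᵛ x)

  open PositiveDefinite

  IsInverse : ∀ {n} → Matrix n n → Matrix n n → Set ℓ₁
  IsInverse A B = (A *ᴹ B) ≋ 1ᴹ × (B *ᴹ A) ≋ 1ᴹ

  IsOneInverse : ∀ {m n} → Matrix m n → Matrix n m → Set ℓ₁
  IsOneInverse M C = (M *ᴹ C *ᴹ M) ≋ M

  block : ∀ n k → Matrix (n ℕ.* k) (n ℕ.* k) → Fin n → Fin n → Matrix k k
  block n k M i j a b = M (combine i a) (combine j b)

  fromBlocks : ∀ n k → (Fin n → Fin n → Matrix k k) →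
               Matrix (n ℕ.* k) (n ℕ.* k)
  fromBlocks n k B p q =
    let (i , a) = remQuot {n} k p
        (j , b) = remQuot {n} k q
    in B i j a b

  -- Positive definite matrices are invertible.  The system A x = v is solved
  -- by recursion on the Schur complement of the top left entry of A.

  private
    module ≈ = SetoidReasoning setoid

  ∙-cong : ∀ {n} {x x′ y y′ : Vector Carrier n} →
           (∀ i → x i ≈ x′ i) → (∀ i → y i ≈ y′ i) → x ∙ y ≈ x′ ∙ y′
  ∙-cong p q = sum-cong-≋ (λ i → *-cong (p i) (q i))

  sum-zero : ∀ {n} (x : Vector Carrier n) → (∀ i → x i ≈ 0#) → sum x ≈ 0#
  sum-zero {n} x p = trans (sum-cong-≋ p) (sum-replicate-zero n)

  ∙-unitʳ : ∀ {n} (x : Vector Carrier n) j → x ∙ (λ i → 1ᴹ i j) ≈ x j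
  ∙-unitʳ {suc n} x zero = trans
    (+-cong (*-identityʳ _)
      (sum-zero (λ i → x (suc i) * 0#) (λ i → zeroʳ _))) (+-identityʳ _)
  ∙-unitʳ {suc n} x (suc j) = trans
    (+-cong (zeroʳ _) (∙-unitʳ (λ i → x (suc i)) j)) (+-identityˡ _)

  1ᴹ-sym : ∀ {n} (i j : Fin n) → 1ᴹ i j ≈ 1ᴹ j i
  1ᴹ-sym zero    zero    = refl
  1ᴹ-sym zero    (suc j) = refl
  1ᴹ-sym (suc i) zero    = refl
  1ᴹ-sym (suc i) (suc j) = 1ᴹ-sym i j

  1#0 : 1# # 0#
  1#0 = invertible⇒# (1# , trans (*-identityˡ _) 1-0 , trans (*-identityʳ _) 1-0)
    where
    1-0 : 1# - 0# ≈ 1#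
    1-0 = trans (+-congˡ -0#≈0#) (+-identityʳ _)

  positive⇒invertible : ∀ {x} → 0# < x → ∃[ y ] x * y ≈ 1#
  positive⇒invertible {x} 0<x
    with #⇒invertible (Equivalence.from #⇔<⊎> (inj₂ 0<x))
  ... | y , _ , eq = y ,
    trans (*-congʳ (sym (trans (+-congˡ -0#≈0#) (+-identityʳ _)))) eq

  corner-positive : ∀ {n} {A : Matrix (suc n) (suc n)} →
                    PositiveDefinite A → 0# < A zero zero
  corner-positive {n} {A} pd =
    proj₁ (IsStrictPartialOrder.<-resp-≈ <-isStrictPartialOrder) eq
      (positive pd e (zero , 1#0))
    where
    e : Vector Carrier (suc n)
    e i = 1ᴹ i zero
    eq : e ∙ (A *ᵛ e) ≈ A zero zero
    eq = trans (sum-cong-≋ (λ i → *-comm (e i) ((A *ᵛ e) i)))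
           (trans (∙-unitʳ (A *ᵛ e) zero) (∙-unitʳ (A zero) zero))

  module Schur {n} (A : Matrix (suc n) (suc n)) (a⁻¹ : Carrier)
               (inv : A zero zero * a⁻¹ ≈ 1#) where

    complement : Matrix n n
    complement i j =
      A (suc i) (suc j) - A (suc i) zero * (a⁻¹ * A zero (suc j))

    -- The vector with tail y whose image under A has first entry z.
    extend : Carrier → Vector Carrier n → Vector Carrier (suc n)
    extend z y zero    = a⁻¹ * (z - (λ j → A zero (suc j)) ∙ y)
    extend z y (suc i) = y i

    extend-zero : ∀ z y → (A *ᵛ extend z y) zero ≈ z
    extend-zero z y = begin
      A zero zero * (a⁻¹ * (z - s)) + s ≈⟨ +-congʳ (sym (*-assoc _ _ _)) ⟩
      A zero zero * a⁻¹ * (z - s) + s   ≈⟨ +-congʳ (*-congʳ inv) ⟩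
      1# * (z - s) + s                  ≈⟨ +-congʳ (*-identityˡ _) ⟩
      z - s + s                         ≈⟨ +-assoc _ _ _ ⟩
      z + (- s + s)                     ≈⟨ +-congˡ (-‿inverseˡ s) ⟩
      z + 0#                            ≈⟨ +-identityʳ z ⟩
      z                                 ∎
      where
      open ≈
      s = (λ j → A zero (suc j)) ∙ y

    complement-*ᵛ : ∀ y i → (complement *ᵛ y) i ≈
      (λ j → A (suc i) (suc j)) ∙ y +
      (A (suc i) zero * a⁻¹) * (- ((λ j → A zero (suc j)) ∙ y))
    complement-*ᵛ y i = begin
      (complement *ᵛ y) i
        ≈⟨ sum-cong-≋ (λ j → trans (distribʳ _ _ _) (+-congˡ (term j))) ⟩
      ∑[ j < n ] (D j * y j + g * (r j * y j))
        ≈⟨ ∑-distrib-+ (λ j → D j * y j) (λ j → g * (r j * y j)) ⟩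
      D ∙ y + ∑[ j < n ] (g * (r j * y j))
        ≈⟨ +-congˡ (sym (*-distribˡ-sum g (λ j → r j * y j))) ⟩
      D ∙ y + g * (r ∙ y)
        ≈⟨ +-congˡ (trans (sym (-‿distribˡ-* _ _)) (-‿distribʳ-* _ _)) ⟩
      D ∙ y + (A (suc i) zero * a⁻¹) * (- (r ∙ y)) ∎
      where
      open ≈
      D = λ j → A (suc i) (suc j)
      r = λ j → A zero (suc j)
      g = - (A (suc i) zero * a⁻¹)
      term : ∀ j → (- (A (suc i) zero * (a⁻¹ * r j))) * y j ≈ g * (r j * y j)
      term j = begin
        (- (A (suc i) zero * (a⁻¹ * r j))) * y j
          ≈⟨ *-congʳ (-‿cong (sym (*-assoc _ _ _))) ⟩
        (- (A (suc i) zero * a⁻¹ * r j)) * y j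
          ≈⟨ *-congʳ (-‿distribˡ-* _ _) ⟩
        g * r j * y j
          ≈⟨ *-assoc _ _ _ ⟩
        g * (r j * y j) ∎

    extend-suc : ∀ z y i → (A *ᵛ extend z y) (suc i) ≈
      (complement *ᵛ y) i + A (suc i) zero * (a⁻¹ * z)
    extend-suc z y i = begin
      b * (a⁻¹ * (z - s)) + D ∙ y      ≈⟨ +-congʳ (sym (*-assoc _ _ _)) ⟩
      b * a⁻¹ * (z - s) + D ∙ y        ≈⟨ +-congʳ (distribˡ _ _ _) ⟩
      b * a⁻¹ * z + b * a⁻¹ * (- s) + D ∙ y ≈⟨ +-assoc _ _ _ ⟩
      b * a⁻¹ * z + (b * a⁻¹ * (- s) + D ∙ y) ≈⟨ +-comm _ _ ⟩
      b * a⁻¹ * (- s) + D ∙ y + b * a⁻¹ * z ≈⟨ +-cong (+-comm _ _) (*-assoc _ _ _) ⟩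
      D ∙ y + b * a⁻¹ * (- s) + b * (a⁻¹ * z)
        ≈⟨ +-congʳ (sym (complement-*ᵛ y i)) ⟩
      (complement *ᵛ y) i + b * (a⁻¹ * z) ∎
      where
      open ≈
      b = A (suc i) zero
      D = λ j → A (suc i) (suc j)
      s = (λ j → A zero (suc j)) ∙ y

    complement-positiveDefinite : PositiveDefinite A → PositiveDefinite complement
    complement-positiveDefinite pd .symmetric i j =
      +-cong (symmetric pd (suc i) (suc j)) (-‿cong (begin
        b i * (a⁻¹ * r j)  ≈⟨ *-cong (symmetric pd (suc i) zero)
                                (*-congˡ (symmetric pd zero (suc j))) ⟩
        r i * (a⁻¹ * b j)  ≈⟨ sym (*-assoc _ _ _) ⟩
        r i * a⁻¹ * b j    ≈⟨ *-comm _ _ ⟩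
        b j * (r i * a⁻¹)  ≈⟨ *-congˡ (*-comm _ _) ⟩
        b j * (a⁻¹ * r i)  ∎))
      where
      open ≈
      b = λ i → A (suc i) zero
      r = λ j → A zero (suc j)
    complement-positiveDefinite pd .positive y (i , yᵢ#0) =
      proj₁ (IsStrictPartialOrder.<-resp-≈ <-isStrictPartialOrder) eq
        (positive pd (extend 0# y) (suc i , yᵢ#0))
      where
      open ≈
      eq : extend 0# y ∙ (A *ᵛ extend 0# y) ≈ y ∙ (complement *ᵛ y)
      eq = trans
        (+-cong (trans (*-congˡ (extend-zero 0# y)) (zeroʳ _))
          (sum-cong-≋ (λ i → *-congˡ {y i} (trans (extend-suc 0# y i)
            (trans (+-congˡ (trans (*-congˡ (zeroʳ _)) (zeroʳ _)))
              (+-identityʳ _))))))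
        (+-identityˡ _)

  solve : ∀ {n} {A : Matrix n n} → PositiveDefinite A →
          ∀ (v : Vector Carrier n) → ∃[ x ] (∀ i → (A *ᵛ x) i ≈ v i)
  solve {zero}          pd v = (λ ()) , λ ()
  solve {suc n} {A = A} pd v = extend (v zero) y , eq
    where
    a⁻¹  = positive⇒invertible (corner-positive pd)
    open Schur A (proj₁ a⁻¹) (proj₂ a⁻¹)
    w : Vector Carrier n
    w i = A (suc i) zero * (proj₁ a⁻¹ * v zero)
    rec = solve (complement-positiveDefinite pd) (λ i → v (suc i) - w i)
    y = proj₁ rec
    eq : ∀ i → (A *ᵛ extend (v zero) y) i ≈ v i
    eq zero    = extend-zero (v zero) y
    eq (suc i) = begin
      (A *ᵛ extend (v zero) y) (suc i) ≈⟨ extend-suc (v zero) y i ⟩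
      (complement *ᵛ y) i + w i        ≈⟨ +-congʳ (proj₂ rec i) ⟩
      v (suc i) - w i + w i            ≈⟨ +-assoc _ _ _ ⟩
      v (suc i) + (- w i + w i)        ≈⟨ +-congˡ (-‿inverseˡ _) ⟩
      v (suc i) + 0#                   ≈⟨ +-identityʳ _ ⟩
      v (suc i)                        ∎
      where open ≈

  inverse : ∀ {n} (A : Matrix n n) → PositiveDefinite A → Matrix n n
  inverse A pd i j = proj₁ (solve pd (λ p → 1ᴹ p j)) i

  inverse-isInverse : ∀ {n} (A : Matrix n n) (pd : PositiveDefinite A) →
                      IsInverse A (inverse A pd)
  inverse-isInverse {n} A pd = AB≋1 , BA≋1
    where
    open ≈
    B = inverse A pd
    AB≋1 : (A *ᴹ B) ≋ 1ᴹ
    AB≋1 i j = proj₂ (solve pd (λ p → 1ᴹ p j)) i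
    BᵀA≋1 : ∀ i j → ∑[ p < n ] (B p i * A p j) ≈ 1ᴹ i j
    BᵀA≋1 i j = trans
      (sum-cong-≋ (λ p → trans (*-comm _ _) (*-congʳ (symmetric pd p j))))
      (trans (AB≋1 j i) (1ᴹ-sym j i))
    B-sym : ∀ i j → B i j ≈ B j i
    B-sym i j = begin
      B i j ≈⟨ sym (∙-unitʳ (λ q → B q j) i) ⟩
      ∑[ q < n ] (B q j * 1ᴹ q i)
        ≈⟨ sum-cong-≋ (λ q → trans (*-comm _ _)
             (*-congʳ (trans (1ᴹ-sym q i) (sym (BᵀA≋1 i q))))) ⟩
      ∑[ q < n ] ((∑[ p < n ] (B p i * A p q)) * B q j)
        ≈⟨ sum-cong-≋ (λ q → *-distribʳ-sum (B q j) (λ p → B p i * A p q)) ⟩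
      ∑[ q < n ] ∑[ p < n ] (B p i * A p q * B q j)
        ≈⟨ ∑-comm (λ q p → B p i * A p q * B q j) ⟩
      ∑[ p < n ] ∑[ q < n ] (B p i * A p q * B q j)
        ≈⟨ sum-cong-≋ (λ p → trans (sum-cong-≋ (λ q → *-assoc (B p i) (A p q) (B q j)))
             (sym (*-distribˡ-sum (B p i) (λ q → A p q * B q j)))) ⟩
      ∑[ p < n ] (B p i * (A *ᴹ B) p j)
        ≈⟨ sum-cong-≋ (λ p → *-congˡ (AB≋1 p j)) ⟩
      ∑[ p < n ] (B p i * 1ᴹ p j) ≈⟨ ∙-unitʳ (λ p → B p i) j ⟩
      B j i ∎
    BA≋1 : (B *ᴹ A) ≋ 1ᴹ
    BA≋1 i j = trans (sum-cong-≋ (λ p → *-congʳ (B-sym i p))) (BᵀA≋1 i j)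


module MatrixWeighted {c ℓ₁ ℓ₂ : Level} (ℝ : RealNumbers c ℓ₁ ℓ₂) where

  open Matrices ℝ public

  record MatrixWeightedGraph (n k : ℕ) : Set (c ⊔ ℓ₁ ⊔ ℓ₂) where
    field
      graph : SimpleGraph n

    open SimpleGraph graph public

    field
      connected  : Connected
      weight     : ∀ i j → i ~ j → Matrix k k
      weight-sym : ∀ i j (e : i ~ j) (e′ : j ~ i) → weight i j e ≋ weight j i e′
      weight-positiveDefinite : ∀ i j (e : i ~ j) → PositiveDefinite (weight i j e)

    -- The inverse of Wᵢⱼ if i and j are adjacent, and 0 otherwise.
    weight⁻¹ : Fin n → Fin n → Matrix k k
    weight⁻¹ i j with T? (adjacent i j)
    ... | yes e = inverse (weight i j e) (weight-positiveDefinite i j e)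
    ... | no  _ = 0ᴹ

    laplacianBlock : Fin n → Fin n → Matrix k k
    laplacianBlock i j with i ≟ j
    ... | yes _ = sumᴹ (weight⁻¹ i)
    ... | no  _ = -ᴹ weight⁻¹ i j

    laplacian : Matrix (n ℕ.* k) (n ℕ.* k)
    laplacian = fromBlocks n k laplacianBlock

    IsResistanceMatrix : Matrix (n ℕ.* k) (n ℕ.* k) → Set (c ⊔ ℓ₁)
    IsResistanceMatrix R = ∃[ C ] IsOneInverse laplacian C ×
      (∀ i j → block n k R i j ≋
        (block n k C i i +ᴹ block n k C j j -ᴹ block n k C i j -ᴹ block n k C j i))

  open MatrixWeightedGraph

  record SameEdgesAndWeights {n k} (G G′ : MatrixWeightedGraph n k) :
         Set (c ⊔ ℓ₁ ⊔ ℓ₂) where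
    field
      sameEdges   : ∀ i j → (_~_ G i j) ⇔ (_~_ G′ i j)
      sameWeights : ∀ i j (e : _~_ G i j) (e′ : _~_ G′ i j) →
                    weight G i j e ≋ weight G′ i j e′

{-# OPTIONS --safe #-}
module Submission where

-- The resistance matrix of a tree determines its Laplacian.  For an edge i ~ j
-- write Eᵢⱼ for the block column with I at i, -I at j and 0 elsewhere, and let h
-- be 1 on the side of i and 0 on the side of j once the edge is deleted, up to an
-- additive constant.  Then Φ = h ⊗ Wᵢⱼ satisfies L Φ = Eᵢⱼ.  For any
-- (1)-inverse C and any edge pq this gives Eᵢⱼᵀ C Eₚq = Φᵀ Eₚq, so the rows
-- of C satisfy Cᵢ - Cⱼ = Φᵀ up to a constant block, and likewise for the columns.
-- Hence R Eᵢⱼ = -2 Φ up to a constant block column, and L R Eᵢⱼ = -2 Eᵢⱼ.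
-- So all block columns of L R + 2 I agree, and it annihilates the Laplacian L′ of
-- the second tree: L R L′ = -2 L′.  Exchanging the trees and transposing, which
-- turns C and R into a (1)-inverse and a resistance matrix again, also
-- L R L′ = -2 L.  Therefore L = L′, and its off-diagonal blocks are the -Wᵢⱼ⁻¹.

open import Defs
open import Algebra.Bundles using (Group)
import Algebra.Properties.CommutativeSemigroup as CommutativeSemigroupProperties
import Algebra.Properties.Group as GroupProperties
import Algebra.Properties.Ring as RingProperties
import Algebra.Properties.Semiring.Sum as SemiringSum
open import Data.Bool.Properties using (T?; T-irrelevant)
open import Data.Empty using (⊥-elim)
open import Data.Fin.Base using (Fin; zero; suc; combine; remQuot; _↑ˡ_; _↑ʳ_)
open import Data.Fin.Properties
  using (_≟_; combine-injective; remQuot-combine; combine-remQuot)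
open import Data.List.Base using (List; []; _∷_; _++_; _∷ʳ_)
import Data.List.Membership.DecPropositional as DecMembership
open import Data.List.Membership.Propositional using (_∈_)
open import Data.List.Relation.Unary.All using ([]; _∷_; head)
open import Data.List.Relation.Unary.All.Properties using (++⁻ˡ; ++⁻ʳ; ¬Any⇒All¬)
open import Data.List.Relation.Unary.AllPairs using ([]; _∷_)
open import Data.List.Relation.Unary.Any using (here; there)
open import Data.List.Relation.Unary.Linked using (Linked; [-]; _∷_)
open import Data.List.Relation.Unary.Unique.Propositional using (Unique)
open import Data.List.Relation.Unary.Unique.Propositional.Properties
  using (Unique[x∷xs]⇒x∉xs)
open import Data.Nat.Base as ℕ using (ℕ; zero; suc; NonZero; ≢-nonZero⁻¹)
open import Data.Product.Base using (∃-syntax; _×_; _,_; proj₁; proj₂; swap)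
open import Data.Sum.Base using (inj₁; inj₂)
open import Data.Vec.Functional using (Vector)
open import Function.Base using (flip; _∘_)
open import Function.Bundles using (Equivalence; mk⇔)
open import Level using (Level)
open import Relation.Binary.Construct.Closure.ReflexiveTransitive
  using (Star; ε; _◅_; _◅◅_)
open import Relation.Binary.PropositionalEquality.Core as ≡ using (_≡_; _≢_)
import Relation.Binary.Reasoning.Setoid as SetoidReasoning
open import Relation.Binary.Structures using (IsStrictPartialOrder)
open import Relation.Nullary using (¬_; Dec; yes; no)

-- Walks in a graph, loop erasure and sums along walks.

-- Cuts a loop-free walk at a vertex `y`: the first list belongs to the cycle that is split off, the
-- second to the walk that remains.
Unique-++⁻ : ∀ {a} {A : Set a} (xs : List A) {y ys} → Unique (xs ++ y ∷ ys) →
             Unique (y ∷ xs) × Unique (y ∷ ys)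
Unique-++⁻ []       u        = [] ∷ [] , u
Unique-++⁻ (x ∷ xs) (x∉ ∷ u) with Unique-++⁻ xs u
... | y∉ ∷ uxs , uys =
  (≡.≢-sym (head (++⁻ʳ xs x∉)) ∷ y∉) ∷ ++⁻ˡ xs x∉ ∷ uxs , uys

module Walks {n : ℕ} (Γ : SimpleGraph n) where

  open SimpleGraph Γ
  open DecMembership (_≟_ {n}) using (_∈?_)

  Walk : Fin n → Fin n → Set
  Walk = Star _~_

  laterVertices : ∀ {p q} → Walk p q → List (Fin n)
  laterVertices ε                 = []
  laterVertices (_◅_ {j = r} _ w) = r ∷ laterVertices w

  vertices : ∀ {p q} → Walk p q → List (Fin n)
  vertices {p} w = p ∷ laterVertices w

  -- Leaving out the endpoint makes a closed walk list each vertex of a cycle once; `linked` puts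
  -- the endpoint back in the form that `Acyclic` asks for.
  earlierVertices : ∀ {p q} → Walk p q → List (Fin n)
  earlierVertices     ε       = []
  earlierVertices {p} (_ ◅ w) = p ∷ earlierVertices w

  vertices-◅◅ : ∀ {p q r} (v : Walk p q) (w : Walk q r) →
                vertices (v ◅◅ w) ≡ earlierVertices v ++ vertices w
  vertices-◅◅     ε       w = ≡.refl
  vertices-◅◅ {p} (_ ◅ v) w = ≡.cong (p ∷_) (vertices-◅◅ v w)

  target∈vertices : ∀ {p q} (w : Walk p q) → q ∈ vertices w
  target∈vertices ε       = here ≡.refl
  target∈vertices (_ ◅ w) = there (target∈vertices w)

  splitAtVertex : ∀ {p q x} (w : Walk p q) → x ∈ vertices w →
                  ∃[ w₁ ] ∃[ w₂ ] w ≡ w₁ ◅◅ w₂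
  splitAtVertex {x = x} w (here ≡.refl) = ε {x = x} , w , ≡.refl
  splitAtVertex (e ◅ w) (there x∈) with splitAtVertex w x∈
  ... | w₁ , w₂ , eq = e ◅ w₁ , w₂ , ≡.cong (e ◅_) eq

  linked : ∀ {p q} (w : Walk p q) → Linked _~_ (earlierVertices w ∷ʳ q)
  linked ε           = [-]
  linked (e ◅ ε)     = e ∷ [-]
  linked (e ◅ d ◅ w) = e ∷ linked (d ◅ w)

  module Circulation {a ℓ} (A : Group a ℓ) (f : Fin n → Fin n → Group.Carrier A)
    (antisymmetric : ∀ p q → Group._≈_ A (Group._∙_ A (f p q) (f q p)) (Group.ε A))
    where

    open Group A hiding (ε)
    open GroupProperties A using (∙-cancelʳ)
    private 1# = Group.ε A

    -- The integral of the discrete 1-form `f` along the walk.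
    total : ∀ {p q} → Walk p q → Carrier
    total ε                     = 1#
    total {p} (_◅_ {j = r} _ w) = f p r ∙ total w

    total-◅◅ : ∀ {p q r} (v : Walk p q) (w : Walk q r) →
               total (v ◅◅ w) ≈ total v ∙ total w
    total-◅◅ ε       w = sym (identityˡ _)
    total-◅◅ (_ ◅ v) w = trans (∙-congˡ (total-◅◅ v w)) (sym (assoc _ _ _))

    module _ (acyclic : Acyclic) where

      -- Length one would be a loop and length three or more a cycle of the graph. What remains is
      -- an edge traversed back and forth, where antisymmetry cancels.
      cycle-total : ∀ {p q} (e : p ~ q) (w : Walk q p) →
                    Unique (p ∷ earlierVertices w) → total (e ◅ w) ≈ 1#
      cycle-total e ε           u = ⊥-elim (~-irrefl ≡.refl e)
      cycle-total e (d ◅ ε)     u = trans (∙-congˡ (identityʳ _)) (antisymmetric _ _)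
      cycle-total e (d ◅ c ◅ w) u = ⊥-elim (acyclic _ _ _ _ u (linked (e ◅ d ◅ c ◅ w)))

      -- If p lies on the loop-free walk v from the next vertex, the edge to
      -- that vertex followed by v as far as p is a cycle, so its total vanishes.
      eraseLoops : ∀ {p q} (w : Walk p q) →
                   ∃[ v ] Unique (vertices {p} {q} v) × total w ≈ total v
      eraseLoops ε = ε , [] ∷ [] , refl
      eraseLoops {p} (e ◅ w) with eraseLoops w
      ... | v , u , w≈v with p ∈? vertices v
      ...   | no p∉ = e ◅ v , ¬Any⇒All¬ _ p∉ ∷ u , ∙-congˡ w≈v
      ...   | yes p∈ with splitAtVertex v p∈
      ...     | v₁ , v₂ , eq with Unique-++⁻ (earlierVertices v₁)
                (≡.subst Unique (≡.trans (≡.cong vertices eq) (vertices-◅◅ v₁ v₂)) u)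
      ...       | u₁ , u₂ = v₂ , u₂ ,
        trans (∙-congˡ (trans w≈v (trans (reflexive (≡.cong total eq)) (total-◅◅ v₁ v₂))))
          (trans (sym (assoc _ _ _))
            (trans (∙-congʳ (cycle-total e v₁ u₁)) (identityˡ _)))

      -- Loop erasure keeps the total, and a closed walk without repeated vertices is empty, since
      -- its source would occur again as its target.
      closedWalk-total : ∀ {p} (w : Walk p p) → total w ≈ 1#
      closedWalk-total w with eraseLoops w
      ... | ε     , _ , w≈ = w≈
      ... | _ ◅ v , u , _  = ⊥-elim (Unique[x∷xs]⇒x∉xs u (target∈vertices v))

      -- The same way back closes up both walks, and the shared factor cancels.
      total-unique : Connected → ∀ {p q} (v w : Walk p q) → total v ≈ total w
      total-unique connected {p} {q} v w =
        ∙-cancelʳ (total back) _ _ (trans (closed v) (sym (closed w)))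
        where
        back : Walk q p
        back = connected q p
        closed : ∀ (v : Walk p q) → total v ∙ total back ≈ 1#
        closed v = trans (sym (total-◅◅ v back)) (closedWalk-total (v ◅◅ back))

-- Arithmetic of the reals, finite sums and matrix algebra.

module RealMatrices {c ℓ₁ ℓ₂ : Level} (ℝ : RealNumbers c ℓ₁ ℓ₂) where

  open RealNumbers ℝ
  open IsStrictPartialOrder <-isStrictPartialOrder using (<-resp-≈)
    renaming (trans to <-trans)
  open Matrices ℝ
  open SemiringSum semiring
  open RingProperties ring
  open CommutativeSemigroupProperties +-commutativeSemigroup
    using () renaming (interchange to +-interchange)
  open SetoidReasoning setoid

  [w-x]+[y-z]≈[w+y]-[x+z] : ∀ w x y z → (w - x) + (y - z) ≈ (w + y) - (x + z)
  [w-x]+[y-z]≈[w+y]-[x+z] w x y z =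
    trans (+-interchange w (- x) y (- z)) (+-congˡ (-‿+-comm x z))

  minus-interchange : ∀ w x y z → (w - x) - (y - z) ≈ (w - y) - (x - z)
  minus-interchange w x y z = begin
    (w - x) - (y - z)   ≈⟨ +-congˡ (-‿+-comm y (- z)) ⟨
    (w - x) + (- y - - z) ≈⟨ +-interchange w (- x) (- y) (- - z) ⟩
    (w - y) + (- x - - z) ≈⟨ +-congˡ (-‿+-comm x (- z)) ⟩
    (w - y) - (x - z)   ∎

  minus-swap : ∀ {w x y z} → w - x ≈ y - z → w - y ≈ x - z
  minus-swap {w} {x} {y} {z} eq = x∙y⁻¹≈ε⇒x≈y _ _
    (trans (minus-interchange w y x z) (x≈y⇒x∙y⁻¹≈ε eq))

  x≈y+z⇒x-z≈y : ∀ {x y z} → x ≈ y + z → x - z ≈ y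
  x≈y+z⇒x-z≈y {x} {y} {z} eq = trans (+-congʳ eq) (trans (+-assoc _ _ _)
    (trans (+-congˡ (-‿inverseʳ z)) (+-identityʳ y)))

  -- Apartness of `1#` and `0#` leaves two cases. If `1# < 0#`, then `- 1#` is positive, and so is
  -- its square, which is `1#`.
  0<1 : 0# < 1#
  0<1 with Equivalence.to #⇔<⊎> 1#0
  ... | inj₂ 0<1 = 0<1
  ... | inj₁ 1<0 = proj₁ <-resp-≈ (trans (-1*x≈-x (- 1#)) (-‿involutive 1#))
                     (*-pos 0<-1 0<-1)
    where
    0<-1 : 0# < (- 1#)
    0<-1 = proj₁ <-resp-≈ (+-identityˡ _)
             (proj₂ <-resp-≈ (-‿inverseʳ 1#) (+-monoˡ-< (- 1#) 1<0))

  0<2 : 0# < (1# + 1#)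
  0<2 = <-trans 0<1 (proj₂ <-resp-≈ (+-identityˡ 1#) (+-monoˡ-< 1# 0<1))

  -- The order makes `1# + 1#` positive and therefore invertible.
  double-injective : ∀ {x y} → x + x ≈ y + y → x ≈ y
  double-injective {x} {y} eq with positive⇒invertible 0<2
  ... | h , 2h≈1 = trans (sym (halve x)) (trans (*-congʳ eq) (halve y))
    where
    halve : ∀ x → (x + x) * h ≈ x
    halve x = begin
      (x + x) * h           ≈⟨ *-congʳ (+-cong (*-identityʳ x) (*-identityʳ x)) ⟨
      (x * 1# + x * 1#) * h ≈⟨ *-congʳ (distribˡ x 1# 1#) ⟨
      x * (1# + 1#) * h     ≈⟨ *-assoc x _ h ⟩
      x * ((1# + 1#) * h)   ≈⟨ *-congˡ 2h≈1 ⟩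
      x * 1#                ≈⟨ *-identityʳ x ⟩
      x                     ∎

  sum-neg : ∀ {n} (x : Vector Carrier n) → ∑[ i < n ] (- x i) ≈ - sum x
  sum-neg {zero}  x = sym -0#≈0#
  sum-neg {suc n} x = trans (+-congˡ (sum-neg (x ∘ suc))) (-‿+-comm _ _)

  ∑-distrib-- : ∀ {n} (x y : Vector Carrier n) →
                ∑[ i < n ] (x i - y i) ≈ sum x - sum y
  ∑-distrib-- x y = trans (∑-distrib-+ x (λ i → - y i)) (+-congˡ (sum-neg y))

  sum-++ : ∀ m {n} (x : Vector Carrier (m ℕ.+ n)) →
           sum x ≈ ∑[ i < m ] x (i ↑ˡ n) + ∑[ j < n ] x (m ↑ʳ j)
  sum-++ zero    x = sym (+-identityˡ _)
  sum-++ (suc m) x = trans (+-congˡ (sum-++ m (x ∘ suc))) (sym (+-assoc _ _ _))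

  sum-combine : ∀ n {k} (x : Vector Carrier (n ℕ.* k)) →
                sum x ≈ ∑[ i < n ] ∑[ a < k ] x (combine i a)
  sum-combine zero        x = refl
  sum-combine (suc n) {k} x =
    trans (sum-++ k x) (+-congˡ (sum-combine n (λ s → x (k ↑ʳ s))))

  1ᴹ-diagonal : ∀ {n} (i : Fin n) → 1ᴹ i i ≈ 1#
  1ᴹ-diagonal zero    = refl
  1ᴹ-diagonal (suc i) = 1ᴹ-diagonal i

  1ᴹ-offDiagonal : ∀ {n} {i j : Fin n} → i ≢ j → 1ᴹ i j ≈ 0#
  1ᴹ-offDiagonal {i = zero}  {zero}  i≢j = ⊥-elim (i≢j ≡.refl)
  1ᴹ-offDiagonal {i = zero}  {suc j} i≢j = refl
  1ᴹ-offDiagonal {i = suc i} {zero}  i≢j = refl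
  1ᴹ-offDiagonal {i = suc i} {suc j} i≢j = 1ᴹ-offDiagonal (i≢j ∘ ≡.cong suc)

  1ᴹ-subst : ∀ {n} (i j : Fin n) (x : Vector Carrier n) →
             1ᴹ i j * x i ≈ 1ᴹ i j * x j
  1ᴹ-subst i j x with i ≟ j
  ... | yes ≡.refl = refl
  ... | no  i≢j    = trans (vanish (x i)) (sym (vanish (x j)))
    where
    vanish : ∀ y → 1ᴹ i j * y ≈ 0#
    vanish y = trans (*-congʳ (1ᴹ-offDiagonal i≢j)) (zeroˡ y)

  1ᴹ-combine : ∀ {n k} (i j : Fin n) (a b : Fin k) →
               1ᴹ i j * 1ᴹ a b ≈ 1ᴹ (combine i a) (combine j b)
  1ᴹ-combine i j a b with i ≟ j | a ≟ b
  ... | yes ≡.refl | yes ≡.refl = trans (*-cong (1ᴹ-diagonal i) (1ᴹ-diagonal a))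
          (trans (*-identityˡ 1#) (sym (1ᴹ-diagonal (combine i a))))
  ... | no i≢j | _ = trans (trans (*-congʳ (1ᴹ-offDiagonal i≢j)) (zeroˡ _))
          (sym (1ᴹ-offDiagonal (i≢j ∘ proj₁ ∘ combine-injective i a j b)))
  ... | _ | no a≢b = trans (trans (*-congˡ (1ᴹ-offDiagonal a≢b)) (zeroʳ _))
          (sym (1ᴹ-offDiagonal (a≢b ∘ proj₂ ∘ combine-injective i a j b)))

  ∙-unitˡ : ∀ {n} (x : Vector Carrier n) j → 1ᴹ j ∙ x ≈ x j
  ∙-unitˡ x j = trans
    (sum-cong-≋ (λ i → trans (*-comm _ _) (*-congˡ (1ᴹ-sym j i)))) (∙-unitʳ x j)

  ∙-distribˡ-- : ∀ {n} (x y z : Vector Carrier n) →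
                 x ∙ (λ i → y i - z i) ≈ x ∙ y - x ∙ z
  ∙-distribˡ-- x y z = trans (sum-cong-≋ (λ i → x[y-z]≈xy-xz (x i) (y i) (z i)))
    (∑-distrib-- (λ i → x i * y i) (λ i → x i * z i))

  ∙-distribˡ-+ : ∀ {n} (x y z : Vector Carrier n) →
                 x ∙ (λ i → y i + z i) ≈ x ∙ y + x ∙ z
  ∙-distribˡ-+ x y z = trans (sum-cong-≋ (λ i → distribˡ (x i) (y i) (z i)))
    (∑-distrib-+ (λ i → x i * y i) (λ i → x i * z i))

  ∙-comm : ∀ {n} (x y : Vector Carrier n) → x ∙ y ≈ y ∙ x
  ∙-comm x y = sum-cong-≋ (λ i → *-comm (x i) (y i))

  ∙-transpose : ∀ {m n} (A : Matrix m n) x y → x ∙ (A *ᵛ y) ≈ (flip A *ᵛ x) ∙ y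
  ∙-transpose {m} {n} A x y = begin
    ∑[ i < m ] (x i * ∑[ j < n ] (A i j * y j))
      ≈⟨ sum-cong-≋ (λ i → *-distribˡ-sum (x i) (λ j → A i j * y j)) ⟩
    ∑[ i < m ] ∑[ j < n ] (x i * (A i j * y j))
      ≈⟨ ∑-comm (λ i j → x i * (A i j * y j)) ⟩
    ∑[ j < n ] ∑[ i < m ] (x i * (A i j * y j))
      ≈⟨ sum-cong-≋ (λ j → sum-cong-≋ (λ i →
           trans (sym (*-assoc (x i) (A i j) (y j))) (*-congʳ (*-comm (x i) (A i j))))) ⟩
    ∑[ j < n ] ∑[ i < m ] (A i j * x i * y j)
      ≈⟨ sum-cong-≋ (λ j → *-distribʳ-sum (y j) (λ i → A i j * x i)) ⟨
    (flip A *ᵛ x) ∙ y ∎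

  *ᵛ-congʳ : ∀ {m n} (A : Matrix m n) {x y : Vector Carrier n} →
             (∀ i → x i ≈ y i) → ∀ i → (A *ᵛ x) i ≈ (A *ᵛ y) i
  *ᵛ-congʳ A eq i = ∙-cong (λ _ → refl) eq

  *ᴹ-*ᵛ-assoc : ∀ {l m n} (A : Matrix l m) (B : Matrix m n) (x : Vector Carrier n) i →
                ((A *ᴹ B) *ᵛ x) i ≈ (A *ᵛ (B *ᵛ x)) i
  *ᴹ-*ᵛ-assoc A B x i = sym (trans (∙-transpose B (A i) x)
    (sum-cong-≋ (λ j → *-congʳ (∙-comm (λ p → B p j) (A i)))))

  *ᴹ-cong : ∀ {l m n} {A A′ : Matrix l m} {B B′ : Matrix m n} →
            A ≋ A′ → B ≋ B′ → (A *ᴹ B) ≋ (A′ *ᴹ B′)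
  *ᴹ-cong A≋ B≋ i j = sum-cong-≋ (λ p → *-cong (A≋ i p) (B≋ p j))

  *ᴹ-assoc : ∀ {l m n o} (A : Matrix l m) (B : Matrix m n) (C : Matrix n o) →
             ((A *ᴹ B) *ᴹ C) ≋ (A *ᴹ (B *ᴹ C))
  *ᴹ-assoc A B C i j = *ᴹ-*ᵛ-assoc A B (λ p → C p j) i

  *ᴹ-transpose : ∀ {l m n} (A : Matrix l m) (B : Matrix m n) →
                 flip (A *ᴹ B) ≋ (flip B *ᴹ flip A)
  *ᴹ-transpose A B i j = ∙-comm (A j) (λ p → B p i)

  -- The two equivalent matrices let this carry `≋` through inversion: symmetry and independence of
  -- the orientation pass from weights to inverse weights, and equality of inverse weights passes
  -- back to weights.
  inverse-unique : ∀ {n} {A A′ B B′ : Matrix n n} → A ≋ A′ →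
                   IsInverse A B → IsInverse A′ B′ → B ≋ B′
  inverse-unique {A = A} {A′} {B} {B′} A≋A′ (_ , BA≋1) (A′B′≋1 , _) i j = begin
    B i j                 ≈⟨ ∙-unitʳ (B i) j ⟨
    (B *ᴹ 1ᴹ) i j         ≈⟨ ∙-cong (λ _ → refl) (λ p → A′B′≋1 p j) ⟨
    (B *ᴹ (A′ *ᴹ B′)) i j ≈⟨ *ᴹ-assoc B A′ B′ i j ⟨
    ((B *ᴹ A′) *ᴹ B′) i j ≈⟨ ∙-cong (λ p → ∙-cong (λ _ → refl) (λ q → A≋A′ q p)) (λ _ → refl) ⟨
    ((B *ᴹ A) *ᴹ B′) i j  ≈⟨ ∙-cong (BA≋1 i) (λ _ → refl) ⟩
    (1ᴹ *ᴹ B′) i j        ≈⟨ ∙-unitˡ (λ p → B′ p j) i ⟩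
    B′ i j                ∎

  isInverse-transpose : ∀ {n} {A B : Matrix n n} → IsInverse A B →
                        IsInverse (flip A) (flip B)
  isInverse-transpose {A = A} {B} (AB≋1 , BA≋1) =
    (λ i j → trans (sym (*ᴹ-transpose B A i j)) (trans (BA≋1 j i) (1ᴹ-sym j i))) ,
    (λ i j → trans (sym (*ᴹ-transpose A B i j)) (trans (AB≋1 j i) (1ᴹ-sym j i)))

  -- (1)-inverses of a symmetric matrix.

  -- With x = L φ and y = L ψ the left side is φᵀ L C L ψ = φᵀ L ψ, so on the image of L the form
  -- does not depend on the choice of `C`.
  oneInverse-form : ∀ {n} {L C : Matrix n n} → L ≋ flip L → IsOneInverse L C →
    ∀ {x y φ ψ} → (∀ i → (L *ᵛ φ) i ≈ x i) → (∀ i → (L *ᵛ ψ) i ≈ y i) →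
    x ∙ (C *ᵛ y) ≈ φ ∙ y
  oneInverse-form {L = L} {C} L-sym LCL≋L {x} {y} {φ} {ψ} Lφ≈x Lψ≈y = begin
    x ∙ (C *ᵛ y)
      ≈⟨ ∙-cong (λ i → trans (sym (Lφ≈x i)) (∙-cong (L-sym i) (λ _ → refl))) (λ _ → refl) ⟩
    (flip L *ᵛ φ) ∙ (C *ᵛ y)
      ≈⟨ ∙-transpose L φ (C *ᵛ y) ⟨
    φ ∙ (L *ᵛ (C *ᵛ y))
      ≈⟨ ∙-cong (λ _ → refl) (*ᵛ-congʳ L (*ᵛ-congʳ C Lψ≈y)) ⟨
    φ ∙ (L *ᵛ (C *ᵛ (L *ᵛ ψ)))
      ≈⟨ ∙-cong (λ _ → refl) (λ i → trans (*ᴹ-*ᵛ-assoc (L *ᴹ C) L ψ i)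
           (*ᴹ-*ᵛ-assoc L C (L *ᵛ ψ) i)) ⟨
    φ ∙ ((L *ᴹ C *ᴹ L) *ᵛ ψ)
      ≈⟨ ∙-cong (λ _ → refl) (λ i → trans (∙-cong (LCL≋L i) (λ _ → refl)) (Lψ≈y i)) ⟩
    φ ∙ y ∎

  -- `C` need not be symmetric; transposing L C L = L makes statements about its rows available for
  -- its columns.
  oneInverse-transpose : ∀ {n} {L C : Matrix n n} → L ≋ flip L →
                         IsOneInverse L C → IsOneInverse L (flip C)
  oneInverse-transpose {L = L} {C} L-sym LCL≋L i j = begin
    ((L *ᴹ flip C) *ᴹ L) i j
      ≈⟨ *ᴹ-assoc L (flip C) L i j ⟩
    (L *ᴹ (flip C *ᴹ L)) i j
      ≈⟨ *ᴹ-cong {A = L} {flip L} L-sym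
           (*ᴹ-cong {A = flip C} {B = L} (λ _ _ → refl) L-sym) i j ⟩
    (flip L *ᴹ (flip C *ᴹ flip L)) i j
      ≈⟨ *ᴹ-cong {A = flip L} (λ _ _ → refl) (*ᴹ-transpose L C) i j ⟨
    (flip L *ᴹ flip (L *ᴹ C)) i j
      ≈⟨ *ᴹ-transpose (L *ᴹ C) L i j ⟨
    (L *ᴹ C *ᴹ L) j i
      ≈⟨ LCL≋L j i ⟩
    L j i
      ≈⟨ L-sym i j ⟨
    L i j ∎

-- The Laplacian of a matrix weighted graph.

module Resistance {c ℓ₁ ℓ₂ : Level} (ℝ : RealNumbers c ℓ₁ ℓ₂) where

  open RealNumbers ℝ
  open MatrixWeighted ℝ
  open RealMatrices ℝ
  open SemiringSum semiring
  open RingProperties ring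
  open CommutativeSemigroupProperties +-commutativeSemigroup
    using () renaming (interchange to +-interchange)
  open SetoidReasoning setoid

  -- The vectors 1 ⊗ u, which every Laplacian annihilates.
  BlockConstant : ∀ n k → Vector Carrier (n ℕ.* k) → Set ℓ₁
  BlockConstant n k v =
    ∀ (p q : Fin n) (a : Fin k) → v (combine p a) ≈ v (combine q a)

  by-blocks : ∀ {ℓ} n k (P : Fin (n ℕ.* k) → Set ℓ) →
              (∀ (i : Fin n) (a : Fin k) → P (combine i a)) → ∀ s → P s
  by-blocks n k P h s =
    let (i , a) = remQuot {n} k s in ≡.subst P (combine-remQuot {n} k s) (h i a)

  module Laplacian {n k} (G : MatrixWeightedGraph n k) where

    open MatrixWeightedGraph G

    weight⁻¹-isInverse : ∀ i j (e : i ~ j) → IsInverse (weight i j e) (weight⁻¹ i j)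
    weight⁻¹-isInverse i j e with T? (adjacent i j)
    -- `weight⁻¹` uses the adjacency proof found by `T?`; it agrees with `e` because proofs of `T`
    -- are unique.
    ... | yes d rewrite T-irrelevant e d = inverse-isInverse _ _
    ... | no ¬e = ⊥-elim (¬e e)

    weight⁻¹-zero : ∀ i j → ¬ i ~ j → weight⁻¹ i j ≋ 0ᴹ
    weight⁻¹-zero i j ¬e a b with T? (adjacent i j)
    ... | yes e = ⊥-elim (¬e e)
    ... | no _  = refl

    weight-symmetric : ∀ i j (e : i ~ j) → weight i j e ≋ flip (weight i j e)
    weight-symmetric i j e =
      PositiveDefinite.symmetric (weight-positiveDefinite i j e)

    weight⁻¹-symmetric : ∀ i j → weight⁻¹ i j ≋ flip (weight⁻¹ i j)
    weight⁻¹-symmetric i j with T? (adjacent i j)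
    ... | yes e = inverse-unique (weight-symmetric i j e)
                    (inverse-isInverse _ _) (isInverse-transpose (inverse-isInverse _ _))
    ... | no _  = λ _ _ → refl

    weight⁻¹-swap : ∀ i j → weight⁻¹ i j ≋ weight⁻¹ j i
    weight⁻¹-swap i j = cases (T? (adjacent i j))
      where
      cases : Dec (i ~ j) → weight⁻¹ i j ≋ weight⁻¹ j i
      cases (yes e) = inverse-unique (weight-sym i j e (~-sym e))
        (weight⁻¹-isInverse i j e) (weight⁻¹-isInverse j i (~-sym e))
      cases (no ¬e) a b = trans (weight⁻¹-zero i j ¬e a b)
        (sym (weight⁻¹-zero j i (¬e ∘ ~-sym) a b))

    laplacian-combine : ∀ i j a b →
      laplacian (combine i a) (combine j b) ≡ laplacianBlock i j a b
    laplacian-combine i j a b =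
      ≡.cong₂ (λ p q → laplacianBlock (proj₁ p) (proj₁ q) (proj₂ p) (proj₂ q))
        (remQuot-combine i a) (remQuot-combine j b)

    laplacian-offDiagonal : ∀ {i j} → i ≢ j → ∀ a b →
      laplacian (combine i a) (combine j b) ≈ - weight⁻¹ i j a b
    laplacian-offDiagonal {i} {j} i≢j a b =
      trans (reflexive (laplacian-combine i j a b)) offDiagonal
      where
      offDiagonal : laplacianBlock i j a b ≈ - weight⁻¹ i j a b
      offDiagonal with i ≟ j
      ... | yes i≡j = ⊥-elim (i≢j i≡j)
      ... | no _    = refl

    -- Removes the case distinction on `i ≟ j`. On the diagonal the subtracted term vanishes because
    -- the graph has no loops.
    laplacianBlock-≈ : ∀ i j a b → laplacianBlock i j a b ≈
                       1ᴹ i j * sumᴹ (weight⁻¹ i) a b - weight⁻¹ i j a b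
    laplacianBlock-≈ i j a b with i ≟ j
    ... | yes ≡.refl = sym (trans
      (+-cong (trans (*-congʳ (1ᴹ-diagonal i)) (*-identityˡ _))
        (trans (-‿cong (weight⁻¹-zero i i (~-irrefl ≡.refl) a b)) -0#≈0#))
      (+-identityʳ _))
    ... | no i≢j = sym (trans
      (+-congʳ (trans (*-congʳ (1ᴹ-offDiagonal i≢j)) (zeroˡ _))) (+-identityˡ _))

    laplacian-symmetric : laplacian ≋ flip laplacian
    laplacian-symmetric s t =
      let (i , a) = remQuot {n} k s
          (j , b) = remQuot {n} k t
      in block-sym i j a b
      where
      block-sym : ∀ i j a b → laplacianBlock i j a b ≈ laplacianBlock j i b a
      block-sym i j a b = begin
        laplacianBlock i j a b
          ≈⟨ laplacianBlock-≈ i j a b ⟩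
        1ᴹ i j * sumᴹ (weight⁻¹ i) a b - weight⁻¹ i j a b
          ≈⟨ +-cong (1ᴹ-subst i j (λ i → sumᴹ (weight⁻¹ i) a b))
               (-‿cong (weight⁻¹-swap i j a b)) ⟩
        1ᴹ i j * sumᴹ (weight⁻¹ j) a b - weight⁻¹ j i a b
          ≈⟨ +-cong (*-cong (1ᴹ-sym i j) (sum-cong-≋ (λ q → weight⁻¹-symmetric j q a b)))
               (-‿cong (weight⁻¹-symmetric j i a b)) ⟩
        1ᴹ j i * sumᴹ (weight⁻¹ j) b a - weight⁻¹ j i b a
          ≈⟨ laplacianBlock-≈ j i b a ⟨
        laplacianBlock j i b a ∎

    -- The diagonal block is the sum of the inverse weights in its row, so it can be shared out
    -- among the off-diagonal terms and only differences of blocks of `v` remain.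
    laplacian-*ᵛ : ∀ v i a → (laplacian *ᵛ v) (combine i a) ≈
      ∑[ j < n ] ∑[ b < k ] (weight⁻¹ i j a b * (v (combine i b) - v (combine j b)))
    laplacian-*ᵛ v i a = begin
      (laplacian *ᵛ v) (combine i a)
        ≈⟨ sum-combine n (λ s → laplacian (combine i a) s * v s) ⟩
      ∑[ j < n ] ∑[ b < k ] (laplacian (combine i a) (combine j b) * v (combine j b))
        ≈⟨ sum-cong-≋ (λ j → sum-cong-≋ (term j)) ⟩
      ∑[ j < n ] ∑[ b < k ] (d b * v (combine j b) * 1ᴹ j i - w j b * v (combine j b))
        ≈⟨ ∑-comm (λ j b → d b * v (combine j b) * 1ᴹ j i - w j b * v (combine j b)) ⟩
      ∑[ b < k ] ∑[ j < n ] (d b * v (combine j b) * 1ᴹ j i - w j b * v (combine j b))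
        ≈⟨ sum-cong-≋ column ⟩
      ∑[ b < k ] ∑[ j < n ] (w j b * (v (combine i b) - v (combine j b)))
        ≈⟨ ∑-comm (λ j b → w j b * (v (combine i b) - v (combine j b))) ⟨
      ∑[ j < n ] ∑[ b < k ] (w j b * (v (combine i b) - v (combine j b))) ∎
      where
      w : Fin n → Fin k → Carrier
      w j b = weight⁻¹ i j a b
      d : Fin k → Carrier
      d b = ∑[ j < n ] w j b
      term : ∀ j b → laplacian (combine i a) (combine j b) * v (combine j b) ≈
             d b * v (combine j b) * 1ᴹ j i - w j b * v (combine j b)
      term j b = trans
        (*-congʳ (trans (reflexive (laplacian-combine i j a b)) (laplacianBlock-≈ i j a b)))
        (trans ([y-z]x≈yx-zx (v (combine j b)) (1ᴹ i j * d b) (w j b))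
          (+-congʳ (trans (*-assoc _ _ _)
            (trans (*-comm _ _) (*-congˡ (1ᴹ-sym i j))))))
      -- For fixed `b` the Kronecker delta selects block `i`; its coefficient `d b` is then expanded
      -- over `j` to meet the off-diagonal terms.
      column : ∀ b →
        ∑[ j < n ] (d b * v (combine j b) * 1ᴹ j i - w j b * v (combine j b)) ≈
        ∑[ j < n ] (w j b * (v (combine i b) - v (combine j b)))
      column b = begin
        ∑[ j < n ] (d b * v (combine j b) * 1ᴹ j i - w j b * v (combine j b))
          ≈⟨ ∑-distrib-- (λ j → d b * v (combine j b) * 1ᴹ j i) (λ j → w j b * v (combine j b)) ⟩
        ∑[ j < n ] (d b * v (combine j b) * 1ᴹ j i) - ∑[ j < n ] (w j b * v (combine j b))
          ≈⟨ +-congʳ (∙-unitʳ (λ j → d b * v (combine j b)) i) ⟩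
        d b * v (combine i b) - ∑[ j < n ] (w j b * v (combine j b))
          ≈⟨ +-congʳ (*-distribʳ-sum (v (combine i b)) (λ j → w j b)) ⟩
        ∑[ j < n ] (w j b * v (combine i b)) - ∑[ j < n ] (w j b * v (combine j b))
          ≈⟨ ∑-distrib-- (λ j → w j b * v (combine i b)) (λ j → w j b * v (combine j b)) ⟨
        ∑[ j < n ] (w j b * v (combine i b) - w j b * v (combine j b))
          ≈⟨ sum-cong-≋ (λ j → x[y-z]≈xy-xz (w j b) (v (combine i b)) (v (combine j b))) ⟨
        ∑[ j < n ] (w j b * (v (combine i b) - v (combine j b))) ∎

    laplacian-blockConstant : ∀ v → BlockConstant n k v → ∀ s → (laplacian *ᵛ v) s ≈ 0#
    laplacian-blockConstant v const = by-blocks n k (λ s → (laplacian *ᵛ v) s ≈ 0#) (λ i a →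
      trans (laplacian-*ᵛ v i a) (sum-zero _ (λ j → sum-zero _ (λ b →
        trans (*-congˡ (x≈y⇒x∙y⁻¹≈ε (const i j b))) (zeroʳ (weight⁻¹ i j a b))))))

    -- By connectedness, equality across edges propagates along a walk, so later claims are checked
    -- on edges only.
    blockConstant-edges : ∀ v →
      (∀ p q a → p ~ q → v (combine p a) ≈ v (combine q a)) → BlockConstant n k v
    blockConstant-edges v edge p q a = along (connected p q)
      where
      along : ∀ {p} → Star _~_ p q → v (combine p a) ≈ v (combine q a)
      along ε       = refl
      along (e ◅ w) = trans (edge _ _ a e) (along w)

  -- The potential belonging to an edge of an acyclic graph.

  module Edge {n k} (G : MatrixWeightedGraph n k)
    (acyclic : MatrixWeightedGraph.Acyclic G)
    {i j : Fin n} (e : MatrixWeightedGraph._~_ G i j) where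

    open MatrixWeightedGraph G
    open Laplacian G

    -- The unit flow along the edge from i to j.  It is the difference of a
    -- function on the vertices, since its total along a walk depends only on
    -- the endpoints.
    edgeFlow : Fin n → Fin n → Carrier
    edgeFlow p q = 1ᴹ p i * 1ᴹ q j - 1ᴹ p j * 1ᴹ q i

    edgeFlow-antisymmetric : ∀ p q → edgeFlow p q + edgeFlow q p ≈ 0#
    edgeFlow-antisymmetric p q = trans
      (+-congˡ (trans (+-cong (*-comm _ _) (-‿cong (*-comm _ _)))
        (sym (⁻¹-anti-homo‿- _ _))))
      (-‿inverseʳ (edgeFlow p q))

    open Walks graph
    open Circulation +-group edgeFlow edgeFlow-antisymmetric

    -- The function h with base point `j`: the net number of crossings from `i` to `j` on a walk to
    -- `j`, which is 1 on the side of `i` and 0 on the side of `j`.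
    height : Fin n → Carrier
    height p = total (connected p j)

    -- The step to `q` followed by the chosen walk from `q` has the same total as the chosen walk
    -- from `p`.
    height-step : ∀ {p q} → p ~ q → height p - height q ≈ edgeFlow p q
    height-step {p} {q} d = x≈y+z⇒x-z≈y
      (total-unique acyclic connected (connected p j) (d ◅ connected q j))

    W : Matrix k k
    W = weight i j e

    -- Column `b` of Φ = h ⊗ Wᵢⱼ; `dipole b` is column `b` of Eᵢⱼ.
    potential : Fin k → Vector Carrier (n ℕ.* k)
    potential b s = let (p , a) = remQuot {n} k s in height p * W a b

    dipole : Fin k → Vector Carrier (n ℕ.* k)
    dipole b s = 1ᴹ s (combine i b) - 1ᴹ s (combine j b)

    potential-combine : ∀ p a b → potential b (combine p a) ≡ height p * W a b
    potential-combine p a b =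
      ≡.cong (λ x → height (proj₁ x) * W (proj₂ x) b) (remQuot-combine p a)

    potential-step : ∀ {p q} → p ~ q → ∀ a b →
      potential b (combine p a) - potential b (combine q a) ≈ edgeFlow p q * W a b
    potential-step {p} {q} d a b = begin
      potential b (combine p a) - potential b (combine q a)
        ≡⟨ ≡.cong₂ _-_ (potential-combine p a b) (potential-combine q a b) ⟩
      height p * W a b - height q * W a b
        ≈⟨ [y-z]x≈yx-zx (W a b) (height p) (height q) ⟨
      (height p - height q) * W a b
        ≈⟨ *-congʳ (height-step d) ⟩
      edgeFlow p q * W a b ∎

    -- Among adjacent vertices the height changes only across the edge between `i` and `j`. So only
    -- the blocks at `i` and `j` are nonzero, and there the inverse weight cancels `W`.
    laplacian-potential : ∀ b s → (laplacian *ᵛ potential b) s ≈ dipole b s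
    laplacian-potential b = by-blocks n k (λ s → (laplacian *ᵛ potential b) s ≈ dipole b s) main
      where
      product : Fin n → Fin n → Matrix k k
      product p q = weight⁻¹ p q *ᴹ W

      term : ∀ p q a → ∑[ r < k ] (weight⁻¹ p q a r *
               (potential b (combine p r) - potential b (combine q r))) ≈
             edgeFlow p q * product p q a b
      term p q a = trans (sum-cong-≋ (cases (T? (adjacent p q))))
        (sym (*-distribˡ-sum (edgeFlow p q) (λ r → weight⁻¹ p q a r * W r b)))
        where
        cases : Dec (p ~ q) → ∀ r → weight⁻¹ p q a r *
                  (potential b (combine p r) - potential b (combine q r)) ≈
                edgeFlow p q * (weight⁻¹ p q a r * W r b)
        cases (yes d) r = begin
          weight⁻¹ p q a r * (potential b (combine p r) - potential b (combine q r))
            ≈⟨ *-congˡ (potential-step d r b) ⟩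
          weight⁻¹ p q a r * (edgeFlow p q * W r b)
            ≈⟨ *-assoc _ _ _ ⟨
          weight⁻¹ p q a r * edgeFlow p q * W r b
            ≈⟨ *-congʳ (*-comm _ _) ⟩
          edgeFlow p q * weight⁻¹ p q a r * W r b
            ≈⟨ *-assoc _ _ _ ⟩
          edgeFlow p q * (weight⁻¹ p q a r * W r b) ∎
        -- Across a non-edge `height-step` says nothing, but the inverse weight makes both sides
        -- zero.
        cases (no ¬d) r = trans (trans (*-congʳ vanish) (zeroˡ _))
          (sym (trans (*-congˡ (trans (*-congʳ vanish) (zeroˡ _))) (zeroʳ _)))
          where vanish = weight⁻¹-zero p q ¬d a r

      pick : ∀ x (y : Vector Carrier n) l → ∑[ q < n ] (x * 1ᴹ q l * y q) ≈ x * y l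
      pick x y l = trans
        (sum-cong-≋ (λ q → trans (*-assoc x (1ᴹ q l) (y q))
          (trans (*-congˡ (*-comm (1ᴹ q l) (y q))) (sym (*-assoc x (y q) (1ᴹ q l))))))
        (∙-unitʳ (λ q → x * y q) l)

      endpoint : ∀ p a l l′ → product l l′ ≋ 1ᴹ →
                 1ᴹ p l * product p l′ a b ≈ 1ᴹ (combine p a) (combine l b)
      endpoint p a l l′ inv = trans (1ᴹ-subst p l (λ p → product p l′ a b))
        (trans (*-congˡ (inv a b)) (1ᴹ-combine p l a b))

      main : ∀ p a → (laplacian *ᵛ potential b) (combine p a) ≈ dipole b (combine p a)
      main p a = begin
        (laplacian *ᵛ potential b) (combine p a)
          ≈⟨ laplacian-*ᵛ (potential b) p a ⟩
        ∑[ q < n ] ∑[ r < k ] (weight⁻¹ p q a r *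
          (potential b (combine p r) - potential b (combine q r)))
          ≈⟨ sum-cong-≋ (λ q → trans (term p q a) ([y-z]x≈yx-zx (product p q a b) _ _)) ⟩
        ∑[ q < n ] (1ᴹ p i * 1ᴹ q j * product p q a b - 1ᴹ p j * 1ᴹ q i * product p q a b)
          ≈⟨ ∑-distrib-- (λ q → 1ᴹ p i * 1ᴹ q j * product p q a b)
               (λ q → 1ᴹ p j * 1ᴹ q i * product p q a b) ⟩
        ∑[ q < n ] (1ᴹ p i * 1ᴹ q j * product p q a b) -
        ∑[ q < n ] (1ᴹ p j * 1ᴹ q i * product p q a b)
          ≈⟨ +-cong (pick (1ᴹ p i) (λ q → product p q a b) j)
               (-‿cong (pick (1ᴹ p j) (λ q → product p q a b) i)) ⟩
        1ᴹ p i * product p j a b - 1ᴹ p j * product p i a b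
          ≈⟨ +-cong (endpoint p a i j (proj₂ (weight⁻¹-isInverse i j e)))
               -- `W` is the weight from `i` to `j`, so the block at `j` has to swap the orientation
               -- of the inverse weight first.
               (-‿cong (endpoint p a j i (λ a b → trans
                 (∙-cong (weight⁻¹-swap j i a) (λ _ → refl))
                 (proj₂ (weight⁻¹-isInverse i j e) a b)))) ⟩
        dipole b (combine p a) ∎

  -- (1)-inverses and resistance matrices of a tree.

  module _ {n k} (G : MatrixWeightedGraph n k)
    (acyclic : MatrixWeightedGraph.Acyclic G) where

    open MatrixWeightedGraph G
    open Laplacian G

    -- The dipole of an edge p ~ q is also in the image of L, so C may be
    -- evaluated between the two dipoles; the differences over all edges suffice
    -- because the graph is connected.
    oneInverse-column : ∀ {C} → IsOneInverse laplacian C →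
      ∀ {i j} (e : i ~ j) a b → let open Edge G acyclic e in ∀ p q →
      (C (combine i a) (combine p b) - C (combine j a) (combine p b)) - potential a (combine p b) ≈
      (C (combine i a) (combine q b) - C (combine j a) (combine q b)) - potential a (combine q b)
    oneInverse-column {C} LCL≋L {i} {j} e a b p q =
      blockConstant-edges
        (λ s → (C (combine i a) s - C (combine j a) s) - potential a s)
        edge p q b
      where
      open Edge G acyclic e
      ∙-dipole : ∀ {p q} (d : p ~ q) b (x : Vector Carrier (n ℕ.* k)) →
                 x ∙ Edge.dipole G acyclic d b ≈ x (combine p b) - x (combine q b)
      ∙-dipole {p} {q} d b x = trans
        (∙-distribˡ-- x (λ s → 1ᴹ s (combine p b)) (λ s → 1ᴹ s (combine q b)))
        (+-cong (∙-unitʳ x (combine p b)) (-‿cong (∙-unitʳ x (combine q b))))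
      edge : ∀ p q b → p ~ q →
        (C (combine i a) (combine p b) - C (combine j a) (combine p b)) - potential a (combine p b) ≈
        (C (combine i a) (combine q b) - C (combine j a) (combine q b)) - potential a (combine q b)
      edge p q b d = minus-swap (trans (minus-interchange _ _ _ _) (begin
        (C ia (combine p b) - C ia (combine q b)) - (C ja (combine p b) - C ja (combine q b))
          ≈⟨ +-cong (∙-dipole d b (C ia)) (-‿cong (∙-dipole d b (C ja))) ⟨
        (C *ᵛ x) ia - (C *ᵛ x) ja
          ≈⟨ ∙-dipole e a (C *ᵛ x) ⟨
        (C *ᵛ x) ∙ dipole a
          ≈⟨ ∙-comm (C *ᵛ x) (dipole a) ⟩
        dipole a ∙ (C *ᵛ x)
          ≈⟨ oneInverse-form laplacian-symmetric LCL≋L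
               (laplacian-potential a) (Edge.laplacian-potential G acyclic d b) ⟩
        potential a ∙ x
          ≈⟨ ∙-dipole d b (potential a) ⟩
        potential a (combine p b) - potential a (combine q b) ∎))
        where
        ia = combine i a
        ja = combine j a
        x = Edge.dipole G acyclic d b

    module _ {R} (isResistance : IsResistanceMatrix R) where

      private
        C = proj₁ isResistance
        LCL≋L = proj₁ (proj₂ isResistance)

      -- In block row r of R Eᵢⱼ the blocks Cᵣᵣ cancel and Cᵢᵢ - Cⱼⱼ does not depend on r. The two
      -- remaining differences of blocks of `C` enter negatively, and each is Φ up to a constant
      -- block.
      resistance-column : ∀ {i j} (e : i ~ j) b →
        let open Edge G acyclic e in
        BlockConstant n k (λ s → (R s (combine i b) - R s (combine j b)) +
                                     (potential b s + potential b s))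
      resistance-column {i} {j} e b p q a = trans (expand p) (trans
        (+-cong (+-congˡ (-‿cong (outer p q))) (-‿cong (inner p q))) (sym (expand q)))
        where
        open Edge G acyclic e
        C⟨_,_⟩ : Fin n → Fin n → Carrier
        C⟨ r , l ⟩ = C (combine r a) (combine l b)
        φ : Fin n → Carrier
        φ r = potential b (combine r a)
        -- The row differences of `C` yield Φ with `a` and `b` exchanged; symmetry of the weight
        -- restores the order.
        φ≈ : ∀ r → potential a (combine r b) ≈ φ r
        φ≈ r = begin
          potential a (combine r b) ≡⟨ potential-combine r b a ⟩
          height r * W b a          ≈⟨ *-congˡ (weight-symmetric i j e b a) ⟩
          height r * W a b          ≡⟨ potential-combine r a b ⟨
          φ r                       ∎
        -- Column differences of `C` are row differences of its transpose, which is again a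
        -- (1)-inverse.
        outer : ∀ p q → (C⟨ p , i ⟩ - C⟨ p , j ⟩) - φ p ≈ (C⟨ q , i ⟩ - C⟨ q , j ⟩) - φ q
        outer = oneInverse-column (oneInverse-transpose laplacian-symmetric LCL≋L) e b a
        inner : ∀ p q → (C⟨ i , p ⟩ - C⟨ j , p ⟩) - φ p ≈ (C⟨ i , q ⟩ - C⟨ j , q ⟩) - φ q
        inner p q = trans (+-congˡ (-‿cong (sym (φ≈ p))))
          (trans (oneInverse-column LCL≋L e a b p q) (+-congˡ (-‿cong (φ≈ q))))
        +-cancel-minus : ∀ x y z → (x + y) - (x + z) ≈ y - z
        +-cancel-minus x y z = trans (sym ([w-x]+[y-z]≈[w+y]-[x+z] x x y z))
          (trans (+-congʳ (-‿inverseʳ x)) (+-identityˡ _))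
        minus-minus : ∀ x y z → x - (y - z) ≈ (x - y) + z
        minus-minus x y z = trans (+-congˡ (trans (sym (-‿+-comm y (- z)))
          (+-congˡ (-‿involutive z)))) (sym (+-assoc _ _ _))
        -- Once `C⟨ r , r ⟩` has cancelled, `r` occurs only in the last two brackets, each of which
        -- absorbs one copy of `φ r`.
        expand : ∀ r →
          (R (combine r a) (combine i b) - R (combine r a) (combine j b)) + (φ r + φ r) ≈
          (C⟨ i , i ⟩ - C⟨ j , j ⟩) - ((C⟨ r , i ⟩ - C⟨ r , j ⟩) - φ r)
            - ((C⟨ i , r ⟩ - C⟨ j , r ⟩) - φ r)
        expand r = begin
          (R (combine r a) (combine i b) - R (combine r a) (combine j b)) + (φ r + φ r)
            ≈⟨ +-congʳ (+-cong (proj₂ (proj₂ isResistance) r i a b)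
                 (-‿cong (proj₂ (proj₂ isResistance) r j a b))) ⟩
          ((C⟨ r , r ⟩ + C⟨ i , i ⟩ - C⟨ r , i ⟩ - C⟨ i , r ⟩) -
           (C⟨ r , r ⟩ + C⟨ j , j ⟩ - C⟨ r , j ⟩ - C⟨ j , r ⟩)) + (φ r + φ r)
            ≈⟨ +-congʳ (trans (minus-interchange _ _ _ _) (+-congʳ
                 (trans (minus-interchange _ _ _ _) (+-congʳ (+-cancel-minus _ _ _))))) ⟩
          ((C⟨ i , i ⟩ - C⟨ j , j ⟩) - (C⟨ r , i ⟩ - C⟨ r , j ⟩)
            - (C⟨ i , r ⟩ - C⟨ j , r ⟩)) + (φ r + φ r)
            ≈⟨ +-interchange _ _ _ _ ⟨
          ((C⟨ i , i ⟩ - C⟨ j , j ⟩) - (C⟨ r , i ⟩ - C⟨ r , j ⟩) + φ r)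
            + (- (C⟨ i , r ⟩ - C⟨ j , r ⟩) + φ r)
            ≈⟨ +-assoc _ _ _ ⟨
          ((C⟨ i , i ⟩ - C⟨ j , j ⟩) - (C⟨ r , i ⟩ - C⟨ r , j ⟩) + φ r)
            - (C⟨ i , r ⟩ - C⟨ j , r ⟩) + φ r
            ≈⟨ minus-minus _ _ _ ⟨
          ((C⟨ i , i ⟩ - C⟨ j , j ⟩) - (C⟨ r , i ⟩ - C⟨ r , j ⟩) + φ r)
            - ((C⟨ i , r ⟩ - C⟨ j , r ⟩) - φ r)
            ≈⟨ +-congʳ (minus-minus _ _ _) ⟨
          (C⟨ i , i ⟩ - C⟨ j , j ⟩) - ((C⟨ r , i ⟩ - C⟨ r , j ⟩) - φ r)
            - ((C⟨ i , r ⟩ - C⟨ j , r ⟩) - φ r) ∎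

      -- Since L Φ = Eᵢⱼ, the difference of the two columns at an edge is L (R Eᵢⱼ + 2 Φ), and L
      -- annihilates this block constant argument.
      laplacian-resistance : ∀ s →
        BlockConstant n k (λ t → (laplacian *ᴹ R) s t + (1ᴹ s t + 1ᴹ s t))
      laplacian-resistance s = blockConstant-edges
        (λ t → (laplacian *ᴹ R) s t + (1ᴹ s t + 1ᴹ s t)) edge
        where
        L = laplacian s
        edge : ∀ i j b → i ~ j →
          (laplacian *ᴹ R) s (combine i b) + (1ᴹ s (combine i b) + 1ᴹ s (combine i b)) ≈
          (laplacian *ᴹ R) s (combine j b) + (1ᴹ s (combine j b) + 1ᴹ s (combine j b))
        edge i j b e = x∙y⁻¹≈ε⇒x≈y _ _ (begin
          (L ∙ Rᵢ + (δᵢ + δᵢ)) - (L ∙ Rⱼ + (δⱼ + δⱼ))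
            ≈⟨ [w-x]+[y-z]≈[w+y]-[x+z] _ _ _ _ ⟨
          (L ∙ Rᵢ - L ∙ Rⱼ) + ((δᵢ + δᵢ) - (δⱼ + δⱼ))
            ≈⟨ +-congˡ ([w-x]+[y-z]≈[w+y]-[x+z] _ _ _ _) ⟨
          (L ∙ Rᵢ - L ∙ Rⱼ) + (dipole b s + dipole b s)
            ≈⟨ +-cong (∙-distribˡ-- L Rᵢ Rⱼ)
                 (+-cong (laplacian-potential b s) (laplacian-potential b s)) ⟨
          L ∙ (λ t → Rᵢ t - Rⱼ t) + (L ∙ potential b + L ∙ potential b)
            ≈⟨ +-congˡ (∙-distribˡ-+ L (potential b) (potential b)) ⟨
          L ∙ (λ t → Rᵢ t - Rⱼ t) + L ∙ (λ t → potential b t + potential b t)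
            ≈⟨ ∙-distribˡ-+ L (λ t → Rᵢ t - Rⱼ t) (λ t → potential b t + potential b t) ⟨
          L ∙ (λ t → (Rᵢ t - Rⱼ t) + (potential b t + potential b t))
            ≈⟨ laplacian-blockConstant _ (resistance-column e b) s ⟩
          0# ∎)
          where
          open Edge G acyclic e
          Rᵢ Rⱼ : Vector Carrier (n ℕ.* k)
          Rᵢ t = R t (combine i b)
          Rⱼ t = R t (combine j b)
          δᵢ = 1ᴹ s (combine i b)
          δⱼ = 1ᴹ s (combine j b)

      -- The rows of L R + 2 I are block constant, so the symmetric L′ annihilates them from the
      -- right.
      laplacian-resistance-laplacian : (G′ : MatrixWeightedGraph n k) →
        let L′ = MatrixWeightedGraph.laplacian G′ in ∀ s t →
        ((laplacian *ᴹ R) *ᴹ L′) s t + (L′ s t + L′ s t) ≈ 0#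
      laplacian-resistance-laplacian G′ s t = begin
        LR ∙ L′ᵗ + (L′ s t + L′ s t)
          ≈⟨ +-cong (∙-comm LR L′ᵗ) (+-cong unit unit) ⟩
        L′ᵗ ∙ LR + (L′ᵗ ∙ 1ᴹ s + L′ᵗ ∙ 1ᴹ s)
          ≈⟨ +-congˡ (∙-distribˡ-+ L′ᵗ (1ᴹ s) (1ᴹ s)) ⟨
        L′ᵗ ∙ LR + L′ᵗ ∙ (λ q → 1ᴹ s q + 1ᴹ s q)
          ≈⟨ ∙-distribˡ-+ L′ᵗ LR (λ q → 1ᴹ s q + 1ᴹ s q) ⟨
        L′ᵗ ∙ (λ q → LR q + (1ᴹ s q + 1ᴹ s q))
          ≈⟨ ∙-cong (λ q → Laplacian.laplacian-symmetric G′ q t) (λ _ → refl) ⟩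
        (L′ *ᵛ (λ q → LR q + (1ᴹ s q + 1ᴹ s q))) t
          ≈⟨ Laplacian.laplacian-blockConstant G′ _ (laplacian-resistance s) t ⟩
        0# ∎
        where
        L′ = MatrixWeightedGraph.laplacian G′
        L′ᵗ LR : Vector Carrier (n ℕ.* k)
        L′ᵗ q = L′ q t
        LR q = (laplacian *ᴹ R) s q
        unit : L′ s t ≈ L′ᵗ ∙ 1ᴹ s
        unit = sym (trans (∙-comm L′ᵗ (1ᴹ s)) (∙-unitˡ L′ᵗ s))

  -- Recovering the Laplacian, the edges and the weights.

  open MatrixWeightedGraph

  -- The transpose of `C` is the witness; only the order of the two diagonal blocks in the formula
  -- differs.
  resistanceMatrix-transpose : ∀ {n k} (G : MatrixWeightedGraph n k) {R} →
    IsResistanceMatrix G R → IsResistanceMatrix G (flip R)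
  resistanceMatrix-transpose G {R} (C , LCL≋L , R≈) =
    flip C , oneInverse-transpose (Laplacian.laplacian-symmetric G) LCL≋L ,
    λ i j a b → trans (R≈ j i b a)
      (+-congʳ (+-congʳ (+-comm _ _)))

  laplacian-unique : ∀ {n k} (G G′ : MatrixWeightedGraph n k) →
    Acyclic G → Acyclic G′ → ∀ {R R′} →
    IsResistanceMatrix G R → IsResistanceMatrix G′ R′ → R ≋ R′ →
    laplacian G ≋ laplacian G′
  laplacian-unique G G′ acyclic acyclic′ {R} {R′} res res′ R≋R′ s t =
    double-injective (+-cancelˡ (((L *ᴹ R) *ᴹ L′) s t) _ _ (begin
      ((L *ᴹ R) *ᴹ L′) s t + (L s t + L s t)
        ≈⟨ +-cong flipped (+-cong (L-sym s t) (L-sym s t)) ⟩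
      ((L′ *ᴹ flip R′) *ᴹ L) t s + (L t s + L t s)
        ≈⟨ laplacian-resistance-laplacian G′ acyclic′
             {flip R′} (resistanceMatrix-transpose G′ {R′} res′) G t s ⟩
      0#
        ≈⟨ laplacian-resistance-laplacian G acyclic res G′ s t ⟨
      ((L *ᴹ R) *ᴹ L′) s t + (L′ s t + L′ s t) ∎))
    where
    L  = laplacian G
    L′ = laplacian G′
    L-sym  = Laplacian.laplacian-symmetric G
    L′-sym = Laplacian.laplacian-symmetric G′
    -- Both Laplacians are symmetric, so the transpose of L R L′ is L′ Rᵀ L, to which the identity
    -- for `G′` applies.
    flipped : ((L *ᴹ R) *ᴹ L′) s t ≈ ((L′ *ᴹ flip R′) *ᴹ L) t s
    flipped = begin
      ((L *ᴹ R) *ᴹ L′) s t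
        ≈⟨ *ᴹ-assoc L R L′ s t ⟩
      (L *ᴹ (R *ᴹ L′)) s t
        ≈⟨ *ᴹ-cong {A = L} {flip L} L-sym (*ᴹ-cong R≋R′ L′-sym) s t ⟩
      (flip L *ᴹ (R′ *ᴹ flip L′)) s t
        ≈⟨ *ᴹ-cong {A = flip L} (λ _ _ → refl) (*ᴹ-transpose L′ (flip R′)) s t ⟨
      (flip L *ᴹ flip (L′ *ᴹ flip R′)) s t
        ≈⟨ *ᴹ-transpose (L′ *ᴹ flip R′) L s t ⟨
      ((L′ *ᴹ flip R′) *ᴹ L) t s ∎

  laplacian-determines-weight⁻¹ : ∀ {n k} (G G′ : MatrixWeightedGraph n k) →
    laplacian G ≋ laplacian G′ → ∀ {i j} → i ≢ j → weight⁻¹ G i j ≋ weight⁻¹ G′ i j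
  laplacian-determines-weight⁻¹ G G′ L≋L′ {i} {j} i≢j a b = -‿injective (trans
    (sym (Laplacian.laplacian-offDiagonal G i≢j a b))
    (trans (L≋L′ (combine i a) (combine j b))
      (Laplacian.laplacian-offDiagonal G′ i≢j a b)))

  -- Tells edges from non-edges, whose block in `weight⁻¹` is zero. The top left entry of A B = I
  -- would read 0 = 1; for `k` equal to 0 there is no such entry and the edges could not be
  -- recovered.
  zeroInverse-absurd : ∀ {k} .{{_ : NonZero k}} {A B : Matrix k k} →
                       IsInverse A B → ¬ B ≋ 0ᴹ
  zeroInverse-absurd {zero}  {{k≢0}} _ _ = ≢-nonZero⁻¹ zero {{k≢0}} ≡.refl
  zeroInverse-absurd {suc k} {A = A} (AB≋1 , _) B≋0 = #-irrefl (sym 0≈1) 1#0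
    where
    0≈1 : 0# ≈ 1#
    0≈1 = trans (sym (sum-zero _ (λ p → trans (*-congˡ (B≋0 p zero)) (zeroʳ (A zero p)))))
            (AB≋1 zero zero)

  laplacian-determines : ∀ {n k} .{{_ : NonZero k}} (G G′ : MatrixWeightedGraph n k) →
    laplacian G ≋ laplacian G′ → SameEdgesAndWeights G G′
  laplacian-determines G G′ L≋L′ = record
    { sameEdges   = λ i j → mk⇔ (edge G G′ L≋L′) (edge G′ G (λ s t → sym (L≋L′ s t)))
    -- Each weight is the inverse of its inverse weight, so `swap` lets uniqueness of inverses run
    -- backwards.
    ; sameWeights = λ i j e e′ → inverse-unique
        (laplacian-determines-weight⁻¹ G G′ L≋L′ (λ i≡j → ~-irrefl G i≡j e))
        (swap (Laplacian.weight⁻¹-isInverse G i j e))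
        (swap (Laplacian.weight⁻¹-isInverse G′ i j e′))
    }
    where
    edge : ∀ G G′ → laplacian G ≋ laplacian G′ → ∀ {i j} → _~_ G i j → _~_ G′ i j
    edge G G′ L≋L′ {i} {j} e with T? (adjacent G′ i j)
    ... | yes e′ = e′
    ... | no ¬e′ = ⊥-elim (zeroInverse-absurd (Laplacian.weight⁻¹-isInverse G i j e)
      (λ a b → trans
        (laplacian-determines-weight⁻¹ G G′ L≋L′ (λ i≡j → ~-irrefl G i≡j e) a b)
        (Laplacian.weight⁻¹-zero G′ i j ¬e′ a b)))

open import Data.Nat.Base using (_*_)

theorem3p9 : ∀ {c ℓ₁ ℓ₂} (ℝ : RealNumbers c ℓ₁ ℓ₂) →
    let open MatrixWeighted ℝ
        open MatrixWeightedGraph in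
    ∀ (n k : ℕ) .{{_ : NonZero k}} (G G′ : MatrixWeightedGraph n k) →
    IsTree G → IsTree G′ →
    ∀ (R R′ : Matrix (n * k) (n * k)) →
    IsResistanceMatrix G R → IsResistanceMatrix G′ R′ →
    R ≋ R′ →
    SameEdgesAndWeights G G′
theorem3p9 ℝ n k G G′ (_ , acyclic) (_ , acyclic′) R R′ res res′ R≋R′ =
  laplacian-determines G G′ (laplacian-unique G G′ acyclic acyclic′ res res′ R≋R′)
  where open Resistance ℝ
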